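{- Let $a$ and $b$ be positive integers and let $d$ be the largest practical number dividing $\gcd(a,b)$. Consider the numbers $an+b$ with $n$ ranging over the nonnegative integers. Then: (a) If there exists a prime $p\le \sigma(d)+1$ such that $p\nmid \frac{a}{d}$, then there are infinitely many practical numbers of the form $an+b$. (b) If $b$ is a practical number and every prime $p\le\sigma(d)+1$ divides $\frac{a}{d}$, then there is exactly one practical number of the form $an+b$ (namely $b$). (c) If $b$ is not a practical number and every prime $p\le\sigma(d)+1$ divides $\frac{a}{d}$, then there are no practical numbers of the form $an+b$.
   Context: A positive integer $N$ is called a practical number if every integer in $[1,N]$ can be expressed as a sum of distinct positive divisors of $N$. $\sigma(N)$ denotes the sum of the positive divisors of $N$. -}

module Defs where

open import Data.List using (List; filter; map; upTo)
open import Data.List.Relation.Unary.All using (All)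
open import Data.List.Relation.Unary.Unique.Propositional using (Unique)
open import Data.Nat using (ℕ; suc; _+_; _*_; _≤_; _<_)
open import Data.Nat.Divisibility using (_∣_; _∣?_)
open import Data.Nat.ListAction using (sum)
open import Data.Product using (∃-syntax; _×_)
open import Relation.Binary.PropositionalEquality using (_≡_)

divisors : ℕ → List ℕ
divisors N = filter (_∣? N) (map suc (upTo N))

σ : ℕ → ℕ
σ N = sum (divisors N)

-- Used only for N > 0, where every e with e ∣ N is automatically positive.
SumOfDistinctDivisors : ℕ → ℕ → Set
SumOfDistinctDivisors N m =
  ∃[ es ] Unique es × All (_∣ N) es × sum es ≡ m

Practical : ℕ → Set
Practical N =
  0 < N × (∀ m → 1 ≤ m → m ≤ N → SumOfDistinctDivisors N m)

LargestPracticalDivisor : ℕ → ℕ → Set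
LargestPracticalDivisor d g =
  Practical d × d ∣ g × (∀ e → Practical e → e ∣ g → e ≤ d)

PracticalOfForm : ℕ → ℕ → ℕ → Set
PracticalOfForm a b N = Practical N × (∃[ n ] N ≡ a * n + b)

-- Infinitude of a set of natural numbers as unboundedness.
InfinitelyMany : (ℕ → Set) → Set
InfinitelyMany P = ∀ k → ∃[ N ] k < N × P N

{-# OPTIONS --safe #-}

-- A positive N is practical iff every divisor e of N is at most one more than
-- the sum of the smaller divisors of N.  From this criterion, multiplying a
-- practical number n by primes ≤ σ n + 1 keeps it practical.  Conversely, if
-- N is practical and d is a proper divisor of N, some prime p ≤ σ d + 1 has
-- d p ∣ N: otherwise all divisors of N up to σ d + 1 divide d, and σ d + 1 is
-- not a sum of distinct divisors of N.
--
-- In cases (b) and (c), such a p for a practical N = a n + b also satisfies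
-- d p ∣ a, hence d p ∣ gcd a b, contradicting the maximality of d; so N = d ≤ b.
-- In case (a), p is coprime to a / d, so for large k one solves
-- t p ^ k ≡ b / d modulo a / d with t < 2 (a / d) ≤ p ^ k, and d p ^ k t is
-- practical.
module Submission where

open import Defs
open import Data.List using (List; []; _∷_; _++_; map; filter; upTo; downFrom; replicate)
open import Data.List.Membership.Propositional using (_∈_)
open import Data.List.Membership.Propositional.Properties
  using (∈-∃++; ∈-++⁺ˡ; ∈-++⁺ʳ; ∈-++⁻; ∈-map⁺; ∈-map⁻; ∈-filter⁺; ∈-filter⁻; ∈-upTo⁺; ∈-downFrom⁺; ∈-downFrom⁻)
open import Data.List.Relation.Binary.Permutation.Propositional.Properties using (shift)
open import Data.List.Relation.Binary.Subset.Propositional using (_⊆_)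
open import Data.List.Relation.Unary.All as All using (All; []; _∷_)
open import Data.List.Relation.Unary.All.Properties using (replicate⁺)
open import Data.List.Relation.Unary.AllPairs using ([]; _∷_)
open import Data.List.Relation.Unary.Any using (here; there)
open import Data.List.Relation.Unary.Unique.Propositional using (Unique)
import Data.List.Relation.Unary.Unique.Propositional.Properties as Unique
open import Data.Nat
open import Data.Nat.Coprimality as Coprime using (Coprime; coprime-divisor; coprime-Bézout)
open import Data.Nat.Divisibility
open import Data.Nat.DivMod
open import Data.Nat.GCD using (gcd; gcd[m,n]∣m; gcd[m,n]∣n; gcd-greatest; module Bézout)
open import Data.Nat.ListAction using (sum; product)
open import Data.Nat.ListAction.Properties using (sum-++; sum-↭; ∈⇒∣product)
open import Data.Nat.Primality
open import Data.Nat.Primality.Factorisation using (factorise; module PrimeFactorisation)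
open import Data.Nat.Properties
open import Data.Nat.Tactic.RingSolver using (solve-∀)
open import Data.Product using (∃-syntax; _×_; _,_; proj₁; proj₂)
open import Data.Sum using (inj₁; inj₂)
open import Relation.Binary.PropositionalEquality
open import Relation.Nullary using (¬_; yes; no; contradiction)
open import Relation.Nullary.Decidable using (_×-dec_)

-- Sums of lists under inclusion and scaling.

sum-mono-⊆ : ∀ {xs ys} → Unique xs → xs ⊆ ys → sum xs ≤ sum ys
sum-mono-⊆ {[]} _ _ = z≤n
sum-mono-⊆ {x ∷ xs} (x∉xs ∷ u) xs⊆ys with ∈-∃++ (xs⊆ys (here refl))
... | as , bs , refl = begin
  x + sum xs           ≤⟨ +-monoʳ-≤ x (sum-mono-⊆ u xs⊆as++bs) ⟩
  x + sum (as ++ bs)   ≡⟨ sum-↭ (shift x as bs) ⟨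
  sum (as ++ x ∷ bs)   ∎
  where
  open ≤-Reasoning
  -- By uniqueness `x` does not recur in the tail `xs`, so deleting one copy of `x` from `ys` loses
  -- nothing that the tail needs.
  xs⊆as++bs : xs ⊆ as ++ bs
  xs⊆as++bs z∈xs with ∈-++⁻ as (xs⊆ys (there z∈xs))
  ... | inj₁ z∈as         = ∈-++⁺ˡ z∈as
  ... | inj₂ (here refl)  = contradiction refl (All.lookup x∉xs z∈xs)
  ... | inj₂ (there z∈bs) = ∈-++⁺ʳ as z∈bs

∈⇒≤sum : ∀ {x xs} → x ∈ xs → x ≤ sum xs
∈⇒≤sum {x} (here {xs = xs} refl) = m≤m+n x (sum xs)
∈⇒≤sum (there {x = y} x∈xs) = m≤n⇒m≤o+n y (∈⇒≤sum x∈xs)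

sum-map-* : ∀ q xs → sum (map (q *_) xs) ≡ q * sum xs
sum-map-* q [] = sym (*-zeroʳ q)
sum-map-* q (x ∷ xs) = trans (cong (q * x +_) (sum-map-* q xs)) (sym (*-distribˡ-+ q x (sum xs)))

-- Divisor lists and bounds for `σ`.

divisorsBelow : ℕ → ℕ → List ℕ
divisorsBelow N k = filter (_∣? N) (downFrom k)

divisorsBelow-unique : ∀ N k → Unique (divisorsBelow N k)
divisorsBelow-unique N k = Unique.filter⁺ (_∣? N) (Unique.downFrom⁺ k)

∈-divisorsBelow⁺ : ∀ {N k e} → e < k → e ∣ N → e ∈ divisorsBelow N k
∈-divisorsBelow⁺ {N} e<k e∣N = ∈-filter⁺ (_∣? N) (∈-downFrom⁺ e<k) e∣N

∈-divisorsBelow⁻ : ∀ {N k e} → e ∈ divisorsBelow N k → e < k × e ∣ N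
∈-divisorsBelow⁻ {N} {k} e∈ with ∈-filter⁻ (_∣? N) {xs = downFrom k} e∈
... | e∈down , e∣N = ∈-downFrom⁻ e∈down , e∣N

∣⇒∈-divisors : ∀ {N e} .{{_ : NonZero N}} → e ∣ N → e ∈ divisors N
∣⇒∈-divisors {N} {zero}  0∣N = contradiction (0∣⇒≡0 0∣N) (≢-nonZero⁻¹ N)
∣⇒∈-divisors {N} {suc e} e∣N = ∈-filter⁺ (_∣? N) (∈-map⁺ suc (∈-upTo⁺ (∣⇒≤ e∣N))) e∣N

divisors-∣ : ∀ {N e} → e ∈ divisors N → e ∣ N
divisors-∣ {N} e∈ = proj₂ (∈-filter⁻ (_∣? N) {xs = map suc (upTo N)} e∈)

divisors-unique : ∀ N → Unique (divisors N)
divisors-unique N = Unique.filter⁺ (_∣? N) (Unique.map⁺ suc-injective (Unique.upTo⁺ N))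

distinct-divisors-sum≤σ : ∀ {N es} .{{_ : NonZero N}} → Unique es → All (_∣ N) es → sum es ≤ σ N
distinct-divisors-sum≤σ u es∣N = sum-mono-⊆ u (λ e∈ → ∣⇒∈-divisors (All.lookup es∣N e∈))

σ-mono-∣ : ∀ {m n} .{{_ : NonZero n}} → m ∣ n → σ m ≤ σ n
σ-mono-∣ {m} m∣n = distinct-divisors-sum≤σ (divisors-unique m)
  (All.tabulate (λ e∈ → ∣-trans (divisors-∣ e∈) m∣n))

n≤σ[n] : ∀ n .{{_ : NonZero n}} → n ≤ σ n
n≤σ[n] n = ∈⇒≤sum (∣⇒∈-divisors ∣-refl)

σ≤sum-divisorsBelow : ∀ N .{{_ : NonZero N}} → σ N ≤ sum (divisorsBelow N (suc N))
σ≤sum-divisorsBelow N = sum-mono-⊆ (divisors-unique N) λ e∈ →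
  ∈-divisorsBelow⁺ (s≤s (∣⇒≤ (divisors-∣ e∈))) (divisors-∣ e∈)

-- Practicality as a gap condition on the divisors.

GapFree : ℕ → Set
GapFree N = ∀ e → e ∣ N → e ≤ suc (sum (divisorsBelow N e))

-- For `e ≥ 2`, represent `e - 1` by distinct divisors: all of them are below `e`, so the divisors
-- below `e` add up to at least `e - 1`.
practical⇒gapFree : ∀ {N} → Practical N → GapFree N
practical⇒gapFree (0<N , rep) 0 e∣N = z≤n
practical⇒gapFree (0<N , rep) 1 e∣N = s≤s z≤n
practical⇒gapFree {N} (0<N , rep) (2+ e) e∣N
  with rep (suc e) (s≤s z≤n) (≤-trans (n≤1+n _) (∣⇒≤ {{>-nonZero 0<N}} e∣N))
... | es , u , es∣N , Σes≡ = s≤s (subst (_≤ sum (divisorsBelow N (2+ e))) Σes≡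
  (sum-mono-⊆ u λ x∈ → ∈-divisorsBelow⁺ (s≤s (subst (_ ≤_) Σes≡ (∈⇒≤sum x∈))) (All.lookup es∣N x∈)))

-- Greedy choice from the largest divisor down: `k` is taken exactly when the smaller divisors
-- cannot reach `m`. The gap condition then gives `k ≤ m`, and the remainder is within reach of the
-- smaller divisors.
gapFree⇒subset-sums : ∀ {N} → GapFree N → ∀ k m → m ≤ sum (divisorsBelow N k) →
  ∃[ es ] Unique es × es ⊆ divisorsBelow N k × sum es ≡ m
gapFree⇒subset-sums gf zero zero z≤n = [] , [] , (λ ()) , refl
-- `downFrom (suc k)` starts with `k`, so deciding `k ∣ N` reduces the divisor list to the one for
-- `k`, with or without `k` in front.
gapFree⇒subset-sums {N} gf (suc k) m m≤ with k ∣? N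
... | no k∤N = gapFree⇒subset-sums gf k m m≤
... | yes k∣N with m ≤? sum (divisorsBelow N k)
...   | yes m≤S with gapFree⇒subset-sums gf k m m≤S
...     | es , u , es⊆ , Σes≡m = es , u , (λ x∈ → there (es⊆ x∈)) , Σes≡m
gapFree⇒subset-sums {N} gf (suc k) m m≤ | yes k∣N | no m≰S
  with gapFree⇒subset-sums gf k (m ∸ k) (m≤n+o⇒m∸n≤o m k m≤)
... | es , u , es⊆ , Σes≡ =
  k ∷ es ,
  All.tabulate (λ x∈ k≡x → <⇒≢ (proj₁ (∈-divisorsBelow⁻ {N} {k} (es⊆ x∈))) (sym k≡x)) ∷ u ,
  (λ { (here eq) → here eq ; (there x∈) → there (es⊆ x∈) }) ,
  trans (cong (k +_) Σes≡) (m+[n∸m]≡n (≤-trans (gf k k∣N) (≰⇒> m≰S)))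

-- The range extends to `σ N` because `practical-*` must represent `q - 1`, which may exceed `n`.
gapFree⇒sumOfDistinctDivisors : ∀ {N} .{{_ : NonZero N}} → GapFree N →
  ∀ m → m ≤ σ N → SumOfDistinctDivisors N m
gapFree⇒sumOfDistinctDivisors {N} gf m m≤σ
  with gapFree⇒subset-sums gf (suc N) m (≤-trans m≤σ (σ≤sum-divisorsBelow N))
... | es , u , es⊆ , Σes≡m =
  es , u , All.tabulate (λ x∈ → proj₂ (∈-divisorsBelow⁻ {N} {suc N} (es⊆ x∈))) , Σes≡m

gapFree⇒practical : ∀ {N} .{{_ : NonZero N}} → GapFree N → Practical N
gapFree⇒practical {N} gf = >-nonZero⁻¹ N , λ m _ m≤N →
  gapFree⇒sumOfDistinctDivisors gf m (≤-trans m≤N (n≤σ[n] N))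

-- Multiplying practical numbers by small factors.

∤⇒coprime : ∀ {p n} → Prime p → p ∤ n → Coprime p n
∤⇒coprime pp p∤n (i∣p , i∣n) with prime⇒irreducible pp i∣p
... | inj₁ i≡1  = i≡1
... | inj₂ refl = contradiction i∣n p∤n

practical-* : ∀ {n q} → Practical n → Prime q → q ≤ σ n + 1 → Practical (q * n)
practical-* {n} {zero} _ q-prime _ = contradiction q-prime ¬prime[0]
practical-* {n} {q@(suc q-1)} n-practical@(0<n , _) q-prime q≤ = gapFree⇒practical gf
  where
  instance
    n≢0 : NonZero n
    n≢0 = >-nonZero 0<n
    qn≢0 : NonZero (q * n)
    qn≢0 = m*n≢0 q n

  n-gapFree : GapFree n
  n-gapFree = practical⇒gapFree n-practical

  gf : GapFree (q * n)
  gf e e∣qn with e ∣? n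
  ... | yes e∣n = ≤-trans (n-gapFree e e∣n) (s≤s (sum-mono-⊆ (divisorsBelow-unique n e) λ x∈ →
    let x<e , x∣n = ∈-divisorsBelow⁻ {n} {e} x∈ in ∈-divisorsBelow⁺ x<e (∣n⇒∣m*n q x∣n)))
  ... | no e∤n with q ∣? e
  ...   | no q∤e = contradiction (coprime-divisor (Coprime.sym (∤⇒coprime q-prime q∤e)) e∣qn) e∤n
  -- For e = q f, the multiples of q among the divisors of q n below e contribute
  -- q times the sum of the divisors of n below f, at least q (f - 1).  The
  -- missing q - 1 is a sum of distinct divisors of n, which are all below q.
  ...   | yes (divides f refl)
          with gapFree⇒sumOfDistinctDivisors n-gapFree q-1 (s≤s⁻¹ (subst (q ≤_) (+-comm (σ n) 1) q≤))
  ...     | es , u , es∣n , Σes≡q-1 = begin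
    f * q                                ≡⟨ *-comm f q ⟩
    q * f                                ≤⟨ *-monoʳ-≤ q (n-gapFree f f∣n) ⟩
    q * suc (sum below-f)                ≡⟨ *-suc q (sum below-f) ⟩
    q + q * sum below-f                  ≡⟨ cong suc (+-comm q-1 _) ⟩
    suc (q * sum below-f + q-1)          ≡⟨ cong suc (cong₂ _+_ (sum-map-* q below-f) Σes≡q-1) ⟨
    suc (sum q-multiples + sum es)       ≡⟨ cong suc (sum-++ q-multiples es) ⟨
    suc (sum (q-multiples ++ es))        ≤⟨ s≤s (sum-mono-⊆ ++-unique ++-⊆) ⟩
    suc (sum (divisorsBelow (q * n) (f * q))) ∎
    where
    open ≤-Reasoning
    below-f q-multiples : List ℕ
    below-f = divisorsBelow n f
    q-multiples = map (q *_) below-f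

    f∣n : f ∣ n
    f∣n = *-cancelˡ-∣ q (subst (_∣ q * n) (*-comm f q) e∣qn)

    f≢0 : NonZero f
    f≢0 = ≢-nonZero λ { refl → ≢-nonZero⁻¹ n (0∣⇒≡0 f∣n) }

    es<q : ∀ {x} → x ∈ es → x < q
    es<q x∈ = s≤s (subst (_ ≤_) Σes≡q-1 (∈⇒≤sum x∈))

    ++-unique : Unique (q-multiples ++ es)
    ++-unique = Unique.++⁺
      (Unique.map⁺ (*-cancelˡ-≡ _ _ q) (divisorsBelow-unique n f)) u disjoint
      where
      -- A positive multiple of `q` is at least `q`, whereas members of `es` are below `q`; the
      -- multiple is positive because 0 does not divide `n`.
      disjoint : ∀ {x} → ¬ (x ∈ q-multiples × x ∈ es)
      disjoint (x∈q , x∈es) with ∈-map⁻ (q *_) x∈q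
      ... | zero , y∈ , _ =
        ≢-nonZero⁻¹ n (0∣⇒≡0 (proj₂ (∈-divisorsBelow⁻ {n} {f} y∈)))
      ... | suc y , _ , refl = <⇒≱ (es<q x∈es) (m≤m*n q (suc y))

    ++-⊆ : q-multiples ++ es ⊆ divisorsBelow (q * n) (f * q)
    ++-⊆ x∈ with ∈-++⁻ q-multiples x∈
    ... | inj₂ x∈es = ∈-divisorsBelow⁺
      (<-≤-trans (es<q x∈es) (m≤n*m q f {{f≢0}})) (∣n⇒∣m*n q (All.lookup es∣n x∈es))
    ... | inj₁ x∈q with ∈-map⁻ (q *_) x∈q
    ...   | y , y∈ , refl = let y<f , y∣n = ∈-divisorsBelow⁻ {n} {f} y∈ in
      ∈-divisorsBelow⁺ (subst (q * y <_) (*-comm q f) (*-monoʳ-< q y<f)) (*-monoʳ-∣ q y∣n)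

-- One bound in terms of `σ n` serves for every factor, since `σ` does not decrease when passing to
-- a multiple.
practical-product-* : ∀ {n ps} → Practical n → All (λ p → Prime p × p ≤ σ n + 1) ps →
  Practical (product ps * n)
practical-product-* {n} {[]} n-practical [] = subst Practical (sym (*-identityˡ n)) n-practical
practical-product-* {n} {p ∷ ps} n-practical ((p-prime , p≤) ∷ rest) =
  subst Practical (sym (*-assoc p (product ps) n))
    (practical-* tail-practical p-prime (≤-trans p≤ (+-monoˡ-≤ 1
      (σ-mono-∣ {{>-nonZero (proj₁ tail-practical)}} (n∣m*n (product ps))))))
  where
  tail-practical : Practical (product ps * n)
  tail-practical = practical-product-* n-practical rest

practical-*-≤ : ∀ {n} m .{{_ : NonZero m}} → Practical n → m ≤ σ n + 1 → Practical (m * n)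
practical-*-≤ {n} m n-practical m≤ = subst (λ x → Practical (x * n)) (sym isFactorisation)
  (practical-product-* n-practical (All.tabulate λ {p} p∈ →
    All.lookup factorsPrime p∈ ,
    ≤-trans (∣⇒≤ (subst (p ∣_) (sym isFactorisation) (∈⇒∣product p∈))) m≤))
  where open PrimeFactorisation (factorise m)

product-replicate : ∀ k p → product (replicate k p) ≡ p ^ k
product-replicate zero p = refl
product-replicate (suc k) p = cong (p *_) (product-replicate k p)

practical-^-* : ∀ {n p} k → Practical n → Prime p → p ≤ σ n + 1 → Practical (p ^ k * n)
practical-^-* {n} {p} k n-practical p-prime p≤ =
  subst (λ x → Practical (x * n)) (product-replicate k p)
    (practical-product-* n-practical (replicate⁺ k (p-prime , p≤)))

-- Proper divisors of a practical number.

prime-factor : ∀ n → .{{NonTrivial n}} → ∃[ p ] Prime p × p ∣ n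
prime-factor 1+n@(2+ _) with factorise 1+n
... | record { factors = p ∷ ps ; isFactorisation = eq ; factorsPrime = p-prime ∷ _ } =
  p , p-prime , subst (p ∣_) (sym eq) (m∣m*n (product ps))

no-common-prime⇒coprime : ∀ {m n} .{{_ : NonZero m}} →
  (∀ {p} → Prime p → p ∣ m → p ∤ n) → Coprime m n
no-common-prime⇒coprime {m} h {zero} (0∣m , _) = contradiction (0∣⇒≡0 0∣m) (≢-nonZero⁻¹ m)
no-common-prime⇒coprime h {1} _ = refl
no-common-prime⇒coprime h {i@(2+ _)} (i∣m , i∣n) with prime-factor i
... | p , p-prime , p∣i = contradiction (∣-trans p∣i i∣n) (h p-prime (∣-trans p∣i i∣m))

practical-cofactor-prime : ∀ {N d} .{{_ : NonZero d}} → Practical N → d ∣ N → d ≢ N →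
  ∃[ p ] Prime p × p ≤ σ d + 1 × p * d ∣ N
practical-cofactor-prime {d = d} (() , _) (divides zero refl) d≢N
practical-cofactor-prime {d = d} _ (divides 1 refl) d≢N = contradiction (sym (*-identityˡ d)) d≢N
practical-cofactor-prime {N} {d} (0<N , rep) (divides m@(2+ _) refl) _
  -- The search bound is strict, hence the `suc`.
  with anyUpTo? (λ p → prime? p ×-dec p ∣? m) (suc (σ d + 1))
... | yes (p , p≤ , p-prime , p∣m) = p , p-prime , s≤s⁻¹ p≤ , *-monoˡ-∣ d p∣m
... | no no-small-prime with prime-factor m
...   | q , q-prime , q∣m with rep (σ d + 1) (m≤n+m 1 (σ d)) σd+1≤N
  where
  open ≤-Reasoning
  -- Without a small prime, the prime factor `q` of the cofactor exceeds `σ d + 1`, which puts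
  -- `σ d + 1` in the range where `N` has representations.
  σd+1≤N : σ d + 1 ≤ m * d
  σd+1≤N = begin
    σ d + 1  ≤⟨ <⇒≤ (≰⇒> λ q≤ → no-small-prime (q , s≤s q≤ , q-prime , q∣m)) ⟩
    q        ≤⟨ ∣⇒≤ q∣m ⟩
    m        ≤⟨ m≤m*n m d ⟩
    m * d    ∎
... | es , u , es∣N , Σes≡ =
  contradiction (≤-trans (≤-reflexive (trans (+-comm 1 (σ d)) (sym Σes≡)))
    (distinct-divisors-sum≤σ u (All.tabulate es∣d))) 1+n≰n
  where
  -- A summand `x` is at most `σ d + 1`, so all its prime factors are small and none divides `m`.
  -- Being coprime to `m` and a divisor of `m * d`, it divides `d`.
  es∣d : ∀ {x} → x ∈ es → x ∣ d
  es∣d {x} x∈ = coprime-divisor (no-common-prime⇒coprime {{x≢0}} λ p-prime p∣x p∣m →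
      no-small-prime (_ , s≤s (≤-trans (∣⇒≤ {{x≢0}} p∣x) x≤) , p-prime , p∣m))
    (All.lookup es∣N x∈)
    where
    x≤ : x ≤ σ d + 1
    x≤ = subst (x ≤_) Σes≡ (∈⇒≤sum x∈)
    x≢0 : NonZero x
    x≢0 = ≢-nonZero λ { refl → >⇒≢ 0<N (0∣⇒≡0 (All.lookup es∣N x∈)) }

-- Powers, linear congruences and progressions.

coprime-^ : ∀ {m n} k → Coprime m n → Coprime (m ^ k) n
coprime-^ {n = n} zero c = Coprime.1-coprimeTo n
coprime-^ {m} (suc k) c (i∣m^ , i∣n) = coprime-^ k c
  (coprime-divisor (λ (j∣i , j∣m) → c (j∣m , ∣-trans j∣i i∣n)) i∣m^ , i∣n)

-- Lets an exponent chosen as a size bound guarantee that the power exceeds that bound.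
n<m^n : ∀ m n → .{{NonTrivial m}} → n < m ^ n
n<m^n m zero = s≤s z≤n
n<m^n m@(2+ _) (suc n) = <-≤-trans (s≤s (n<m^n m n))
  (^-monoʳ-< m (s≤s (s≤s z≤n)) (n<1+n n))

coprime⇒∃*≡% : ∀ {m n} .{{_ : NonZero n}} → Coprime m n → ∀ b → ∃[ t ] (t * m) % n ≡ b % n
coprime⇒∃*≡% {m} {n@(suc n-1)} c b with coprime-Bézout c
-- Here `x` inverts `m` modulo `n`.
... | Bézout.+- x y eq = x * b , (begin
  (x * b * m) % n          ≡⟨ cong (_% n) (rearrange₁ x b m) ⟩
  (b * (x * m)) % n        ≡⟨ cong (λ z → (b * z) % n) eq ⟨
  (b * (1 + y * n)) % n    ≡⟨ cong (_% n) (rearrange₂ b y n) ⟩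
  (b + b * y * n) % n      ≡⟨ [m+kn]%n≡m%n b (b * y) n ⟩
  b % n                    ∎)
  where
  open ≡-Reasoning
  rearrange₁ : ∀ x b m → x * b * m ≡ b * (x * m)
  rearrange₁ = solve-∀
  rearrange₂ : ∀ b y n → b * (1 + y * n) ≡ b + b * y * n
  rearrange₂ = solve-∀
-- Here x m ≡ -1, and n - 1 supplies the other sign.
... | Bézout.-+ x y eq = x * b * n-1 , (begin
  (x * b * n-1 * m) % n                    ≡⟨ [m+kn]%n≡m%n (x * b * n-1 * m) (b * y) n ⟨
  (x * b * n-1 * m + b * y * n) % n        ≡⟨ cong (λ z → (x * b * n-1 * m + z) % n) (*-assoc b y n) ⟩
  (x * b * n-1 * m + b * (y * n)) % n      ≡⟨ cong (λ z → (x * b * n-1 * m + b * z) % n) eq ⟨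
  (x * b * n-1 * m + b * (1 + x * m)) % n  ≡⟨ cong (_% n) (rearrange x b n-1 m) ⟩
  (b + x * m * b * n) % n                  ≡⟨ [m+kn]%n≡m%n b (x * m * b) n ⟩
  b % n                                    ∎)
  where
  open ≡-Reasoning
  rearrange : ∀ x b k m → x * b * k * m + b * (1 + x * m) ≡ b + x * m * b * suc k
  rearrange = solve-∀

coprime⇒∃*≡%-bounded : ∀ {m n} .{{_ : NonZero n}} → Coprime m n → ∀ b →
  ∃[ t ] 0 < t × t ≤ n + n × (t * m) % n ≡ b % n
coprime⇒∃*≡%-bounded {m} {n} c b with coprime⇒∃*≡% c b
-- The residue `s % n` may be 0; adding `n` makes the solution positive.
... | s , sm≡b = s % n + n , m≤n⇒m≤o+n (s % n) (>-nonZero⁻¹ n) , +-monoˡ-≤ n (m%n≤n s n) , (begin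
  ((s % n + n) * m) % n                ≡⟨ cong (_% n) (rearrange₁ (s % n) n m) ⟩
  (s % n * m + m * n) % n              ≡⟨ [m+kn]%n≡m%n (s % n * m) m n ⟩
  (s % n * m) % n                      ≡⟨ [m+kn]%n≡m%n (s % n * m) (s / n * m) n ⟨
  (s % n * m + s / n * m * n) % n      ≡⟨ cong (_% n) (rearrange₂ (s % n) (s / n) n m) ⟨
  ((s % n + s / n * n) * m) % n        ≡⟨ cong (λ z → (z * m) % n) (m≡m%n+[m/n]*n s n) ⟨
  (s * m) % n                          ≡⟨ sm≡b ⟩
  b % n                                ∎)
  where
  open ≡-Reasoning
  rearrange₁ : ∀ r n m → (r + n) * m ≡ r * m + m * n
  rearrange₁ = solve-∀
  rearrange₂ : ∀ r q n m → (r + q * n) * m ≡ r * m + q * m * n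
  rearrange₂ = solve-∀

≡%⇒progression : ∀ a {b m} .{{_ : NonZero a}} → b ≤ m → m % a ≡ b % a → ∃[ n ] m ≡ a * n + b
≡%⇒progression a {b} {m} b≤m m≡b = n , (begin
  m                              ≡⟨ m≡m%n+[m/n]*n m a ⟩
  m % a + m / a * a              ≡⟨ cong₂ (λ r q → r + q * a) m≡b (sym (m+[n∸m]≡n (/-monoˡ-≤ a b≤m))) ⟩
  b % a + (b / a + n) * a        ≡⟨ rearrange (b % a) (b / a) n a ⟩
  a * n + (b % a + b / a * a)    ≡⟨ cong (a * n +_) (m≡m%n+[m/n]*n b a) ⟨
  a * n + b                      ∎)
  where
  open ≡-Reasoning
  -- Equal remainders leave only the quotients to compare, and `b ≤ m` keeps this subtraction from
  -- being truncated.
  n : ℕ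
  n = m / a ∸ b / a
  rearrange : ∀ r q n a → r + (q + n) * a ≡ a * n + (r + q * a)
  rearrange = solve-∀

-- Practical numbers in the progression.

practicals-unbounded : ∀ {a b d p} .{{_ : NonZero a}} → Practical d → Prime p →
  p ≤ σ d + 1 → p ∤ a → InfinitelyMany (PracticalOfForm (a * d) (b * d))
practicals-unbounded {a} {b} {d} {p} d-practical p-prime p≤ p∤a k
  with coprime⇒∃*≡%-bounded (coprime-^ (k + (a + a) + b) (∤⇒coprime p-prime p∤a)) b
... | t , 0<t , t≤2a , tP≡b = t * (P * d) ,
      ≤-trans (≤-<-trans (≤-trans (m≤m+n k (a + a)) (m≤m+n _ b)) K<P)
        (≤-trans (m≤m*n P d) (m≤n*m (P * d) t)) ,
      practical-*-≤ t Pd-practical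
        (≤-trans t≤2a (≤-trans 2a≤P (≤-trans (m≤m*n P d)
          (≤-trans (n≤σ[n] (P * d) {{>-nonZero (proj₁ Pd-practical)}}) (m≤m+n _ 1))))) ,
      proj₁ tP-form , (begin
        t * (P * d)             ≡⟨ *-assoc t P d ⟨
        t * P * d               ≡⟨ cong (_* d) (proj₂ tP-form) ⟩
        (a * proj₁ tP-form + b) * d  ≡⟨ rearrange a (proj₁ tP-form) b d ⟩
        a * d * proj₁ tP-form + b * d ∎)
  where
  open ≡-Reasoning
  rearrange : ∀ a n b d → (a * n + b) * d ≡ a * d * n + b * d
  rearrange = solve-∀
  instance
    d≢0 : NonZero d
    d≢0 = >-nonZero (proj₁ d-practical)
    t≢0 : NonZero t
    t≢0 = >-nonZero 0<t
  -- The three summands of `K` make `P` exceed `k` for unboundedness, `a + a ≥ t` so that `t` is a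
  -- permitted factor, and `b` so that the progression index is natural.
  K P : ℕ
  K = k + (a + a) + b
  P = p ^ K
  K<P : K < P
  K<P = n<m^n p K {{prime⇒nonTrivial p-prime}}
  2a≤P : a + a ≤ P
  2a≤P = ≤-trans (≤-trans (m≤n+m (a + a) k) (m≤m+n _ b)) (<⇒≤ K<P)
  Pd-practical : Practical (P * d)
  Pd-practical = practical-^-* K d-practical p-prime p≤
  tP-form : ∃[ n ] t * P ≡ a * n + b
  tP-form = ≡%⇒progression a (≤-trans (≤-trans (m≤n+m b (k + (a + a))) (<⇒≤ K<P)) (m≤n*m P t)) tP≡b

practicalOfForm⇒≡b : ∀ {a b d N} .{{_ : NonZero b}} .{{_ : NonZero d}} →
  LargestPracticalDivisor d (gcd a b) → (∀ p → Prime p → p ≤ σ d + 1 → p ∣ a / d) →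
  PracticalOfForm a b N → N ≡ b
practicalOfForm⇒≡b {a} {b} {d} {N} (d-practical , d∣gcd , d-largest) small∣a/d (N-practical , n , N≡an+b)
  with d ≟ N
-- Now `N` divides `b`, so `N ≤ b`, while `N ≡ a * n + b` gives `b ≤ N`.
... | yes refl = ≤-antisym (∣⇒≤ (∣-trans d∣gcd (gcd[m,n]∣n a b)))
  (subst (b ≤_) (sym N≡an+b) (m≤n+m b (a * n)))
... | no d≢N with practical-cofactor-prime N-practical d∣N d≢N
  where
  d∣N : d ∣ N
  d∣N = subst (d ∣_) (sym N≡an+b)
    (∣m∣n⇒∣m+n (∣m⇒∣m*n n (∣-trans d∣gcd (gcd[m,n]∣m a b))) (∣-trans d∣gcd (gcd[m,n]∣n a b)))
... | p , p-prime , p≤ , pd∣N =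
  contradiction (d-largest (p * d) (practical-* d-practical p-prime p≤) (gcd-greatest pd∣a pd∣b))
    (<⇒≱ (subst (d <_) (*-comm d p) (m<m*n d p (nonTrivial⇒n>1 p {{prime⇒nonTrivial p-prime}}))))
  where
  pd∣a : p * d ∣ a
  pd∣a = m∣n/o⇒m*o∣n (∣-trans d∣gcd (gcd[m,n]∣m a b)) (small∣a/d p p-prime p≤)
  pd∣b : p * d ∣ b
  pd∣b = ∣m+n∣m⇒∣n (subst (p * d ∣_) N≡an+b pd∣N) (∣m⇒∣m*n n pd∣a)

theorem2p2 : (a b : ℕ) .{{_ : NonZero a}} .{{_ : NonZero b}} →
    (d : ℕ) .{{_ : NonZero d}} → LargestPracticalDivisor d (gcd a b) →
    ((∃[ p ] Prime p × p ≤ σ d + 1 × p ∤ a / d) →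
    InfinitelyMany (PracticalOfForm a b))
    ×
    (Practical b → (∀ p → Prime p → p ≤ σ d + 1 → p ∣ a / d) →
    PracticalOfForm a b b × (∀ N → PracticalOfForm a b N → N ≡ b))
    ×
    (¬ Practical b → (∀ p → Prime p → p ≤ σ d + 1 → p ∣ a / d) →
    ∀ N → ¬ PracticalOfForm a b N)
theorem2p2 a b d largest@(d-practical , d∣gcd , _) =
  (λ (p , p-prime , p≤ , p∤a/d) →
    -- The common factor `d` was split off so that `p` is coprime to the modulus `a / d`; here it is
    -- restored.
    subst₂ (λ x y → InfinitelyMany (PracticalOfForm x y)) (m/n*n≡m d∣a) (m/n*n≡m d∣b)
      (practicals-unbounded {b = b / d} {{a/d≢0}} d-practical p-prime p≤ p∤a/d)) ,
  (λ b-practical small∣a/d →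
    (b-practical , 0 , cong (_+ b) (sym (*-zeroʳ a))) ,
    λ N → practicalOfForm⇒≡b largest small∣a/d) ,
  λ ¬b-practical small∣a/d N N-form →
    ¬b-practical (subst Practical (practicalOfForm⇒≡b largest small∣a/d N-form) (proj₁ N-form))
  where
  d∣a : d ∣ a
  d∣a = ∣-trans d∣gcd (gcd[m,n]∣m a b)
  d∣b : d ∣ b
  d∣b = ∣-trans d∣gcd (gcd[m,n]∣n a b)
  a/d≢0 : NonZero (a / d)
  a/d≢0 = >-nonZero (m≥n⇒m/n>0 (∣⇒≤ d∣a))
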